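{- Let $n\geq 2$ and $1\leq k\leq n-1$. The cycle-prefix digraph $\mathrm{CP}(n,k)=\mathcal{G}(S_n,H_k,\{\gamma(2),\ldots,\gamma(n-k+1)\})$ is optimally vertex connected, i.e. its vertex connectivity equals its degree $n-1$.
   Context: $S_n$ is the group of permutations of $\{1,\ldots,n\}$. A permutation $\pi$ mapping $i$ to $\pi_i$ is written $\pi=\pi_1\pi_2\ldots\pi_n$; permutations act on the right ($i\pi=\pi_i$) and compose by $i(\pi\sigma)=(i\pi)\sigma$. For $2\le j\le n$, $\gamma(j)=j\,1\,2\ldots(j-1)(j+1)\ldots n$ is the permutation cyclically permuting $\{1,\ldots,j\}$ to the right and fixing all other points. $H_k$ is the subgroup of $S_n$ of permutations $\pi$ with $\pi_i=i$ for all $i\leq n-k$. For a group $G$, subgroup $H$ and $S\subseteq G\setminus H$, the Cayley coset digraph $\mathcal{G}(G,H,S)$ has vertex set the left cosets $gH$, with $(gH,g'H)$ an edge iff $gHs\cap g'H\neq\emptyset$ for some $s\in S$; $\mathrm{CP}(n,k)$ has out-degree $n-1$ at every vertex. The vertex connectivity is the smallest number of vertices whose removal leaves a digraph that is not strongly connected (for a complete digraph on $m$ vertices it is taken to be $m-1$). -}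

module Defs where

open import Data.Nat using (ℕ; zero; suc; _≤_; _<_; _∸_)
open import Data.Fin using (Fin; toℕ)
open import Data.Fin.Permutation using (Permutation′; _⟨$⟩ʳ_)
open import Data.List using (List; length)
open import Data.List.Relation.Unary.Any using (Any)
open import Data.List.Relation.Unary.AllPairs using (AllPairs)
open import Data.Product using (Σ; ∃; ∃-syntax; _×_)
open import Data.Sum using (_⊎_)
open import Relation.Nullary using (¬_)
open import Relation.Binary.PropositionalEquality using (_≡_)

-- Generic digraphs whose vertices are given by representatives modulo
-- an equivalence _≈_ (used for vertices = left cosets gH).

record Digraph : Set₁ where
  field
    V   : Set
    _≈_ : V → V → Set
    E   : V → V → Set

module _ (D : Digraph) where
  open Digraph D

  _∈V_ : V → List V → Set
  v ∈V X = Any (v ≈_) X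

  -- X lists pairwise distinct vertices, so |X| = length X
  DistinctV : List V → Set
  DistinctV X = AllPairs (λ a b → ¬ (a ≈ b)) X

  data PathAvoiding (X : List V) : V → V → Set where
    stop : ∀ {u v} → u ≈ v → PathAvoiding X u v
    step : ∀ {u w v} → E u w → ¬ (w ∈V X) → PathAvoiding X w v → PathAvoiding X u v

  StronglyConnectedWithout : List V → Set
  StronglyConnectedWithout X =
    ∀ u v → ¬ (u ∈V X) → ¬ (v ∈V X) → PathAvoiding X u v

  Complete : Set
  Complete = ∀ u v → ¬ (u ≈ v) → E u v

  HasOrder : ℕ → Set
  HasOrder m = Σ (List V) λ xs →
    DistinctV xs × (∀ v → v ∈V xs) × length xs ≡ m

  IsVertexConnectivity : ℕ → Set
  IsVertexConnectivity c =
      (Complete × ∃[ m ] (HasOrder m × c ≡ m ∸ 1))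
    ⊎ (¬ Complete
       × (∃[ X ] (DistinctV X × length X ≡ c × ¬ StronglyConnectedWithout X))
       × (∀ X → DistinctV X → length X < c → StronglyConnectedWithout X))

-- The cycle-prefix digraph.  Fin n = {0,…,n-1} encodes {1,…,n} via
-- i ↦ 1 + toℕ i.  Permutations act on the right: i(πσ) = (iπ)σ, so the
-- product g·h maps i to h ⟨$⟩ʳ (g ⟨$⟩ʳ i).

InH : (n k : ℕ) → Permutation′ n → Set
InH n k h = ∀ (i : Fin n) → suc (toℕ i) ≤ n ∸ k → h ⟨$⟩ʳ i ≡ i

-- γ(j) acting on 1-based points: 1 ↦ j, x ↦ x-1 for 2 ≤ x ≤ j, x ↦ x otherwise
γ : ℕ → ℕ → ℕ
γ j zero = zero
γ j (suc zero) = j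
γ j (suc (suc x)) with suc (suc x) Data.Nat.≤? j
... | Relation.Nullary.yes _ = suc x
... | Relation.Nullary.no  _ = suc (suc x)

SameCoset : (n k : ℕ) → Permutation′ n → Permutation′ n → Set
SameCoset n k g g' = ∃[ h ] (InH n k h × (∀ i → g' ⟨$⟩ʳ i ≡ h ⟨$⟩ʳ (g ⟨$⟩ʳ i)))

-- (gH, g'H) is an edge iff gH·s ∩ g'H ≠ ∅ for some s = γ(j), 2 ≤ j ≤ n-k+1,
-- i.e. g·h·γ(j) = g'·h' for some h, h' ∈ H_k
CPEdge : (n k : ℕ) → Permutation′ n → Permutation′ n → Set
CPEdge n k g g' =
  ∃[ j ] (2 ≤ j × j ≤ suc (n ∸ k) ×
    ∃[ h ] ∃[ h' ] (InH n k h × InH n k h' ×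
      (∀ i → γ j (suc (toℕ (h ⟨$⟩ʳ (g ⟨$⟩ʳ i))))
             ≡ suc (toℕ (h' ⟨$⟩ʳ (g' ⟨$⟩ʳ i))))))

CP : ℕ → ℕ → Digraph
CP n k = record { V = Permutation′ n ; _≈_ = SameCoset n k ; E = CPEdge n k }

{-# OPTIONS --safe #-}
module Submission where

-- A vertex gH is determined by its word, the letters g⁻¹(1) … g⁻¹(r) with
-- r = n − k, and (gH, g'H) is an edge iff the word of g arises from that of g'
-- by moving a letter other than the first to the front, or by pushing an absent
-- letter in front and dropping the last one.  So, read backwards, a path is a
-- sequence of requests to a move-to-front list with r visible places.
--
-- Removing the n − 1 predecessors of a vertex disconnects.  Conversely, delete a
-- set X of fewer than n − 1 words, and let the target be T = a T'.  First bring
-- a to the front: request a, or any y and then a.  Then, from a word starting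
-- with a, request for some y ≠ a the letter y and the letters of T' from right to
-- left, then a.  If T' = p y q, then instead of y request a, y (nothing if q is
-- empty) between q and p.  Along the route of y the letter in front of a in the
-- current word is always y (if a has dropped off, y is the last letter), except
-- right after the intermediate request of a, when the current word starts with
-- a c and y is in front of c in T.  Thus the routes are disjoint, and X misses
-- one of them.

open import Defs
open import Data.Bool using (if_then_else_)
open import Data.Fin using (Fin; zero; suc; toℕ; fromℕ<; punchIn; _≟_)
open import Data.Fin.Permutation
  using (Permutation′; _⟨$⟩ʳ_; _⟨$⟩ˡ_; inverseˡ; inverseʳ; _∘ₚ_; flip; insert; id; lift₀)
open import Data.Fin.Properties as Finₚ using (toℕ-injective; toℕ-fromℕ<; any?; injective⇒≤)
open import Data.List using (List; []; _∷_; [_]; _++_; length; map; take; tabulate; lookup)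
open import Data.List.Membership.DecPropositional using () renaming (_∈?_ to mem?)
open import Data.List.Membership.Propositional using (_∈_; _∉_)
open import Data.List.Membership.Propositional.Properties
  using (∈-map⁺; ∈-++⁻; ∈-∃++; ∈-tabulate⁺; ∈-++⁺ʳ)
open import Data.List.Properties
  using (length-map; length-take; length-tabulate; length-++; ++-assoc; take-all; ∷-injectiveˡ; ∷-injectiveʳ)
open import Data.List.Relation.Binary.Permutation.Propositional
  using (_↭_; ↭⇒↭ₛ; ↭-trans; ↭-sym; ↭-swap; ↭-refl)
open import Data.List.Relation.Binary.Permutation.Propositional.Properties using (shift; ++-comm; ++⁺ˡ)
import Data.List.Relation.Binary.Permutation.Setoid.Properties as Permutationₛ
open import Data.List.Relation.Unary.All using ([]; _∷_)
open import Data.List.Relation.Unary.All.Properties using (All¬⇒¬Any; ¬Any⇒All¬)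
open import Data.List.Relation.Unary.AllPairs using ([]; _∷_)
import Data.List.Relation.Unary.AllPairs.Properties as AllPairsₚ
open import Data.List.Relation.Unary.Any using (here; there; index)
open import Data.List.Relation.Unary.Any.Properties as Anyₚ using (lookup-index)
open import Data.List.Relation.Unary.Unique.Propositional using (Unique)
import Data.List.Relation.Unary.Unique.Propositional.Properties as Uniqueₚ
open import Data.Nat using (ℕ; zero; suc; _≤_; _<_; _∸_; z≤n; s≤s; _≤?_; _<?_)
open import Data.Nat.Properties
  using (≤-trans; ≤-refl; ≤-reflexive; <⇒≤; <⇒≱; ≮⇒≥; <-≤-trans; suc-injective; m<m+n; m≤m+n; m≤n+m;
         n≤1+n; m≤n⇒m⊓n≡m; m≤n⇒m<n∨m≡n; m<n⇒0<n∸m; ∸-monoʳ-≤)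
open import Data.Product using (∃; ∃-syntax; _×_; _,_; proj₁; proj₂)
open import Data.Sum using (inj₁; inj₂)
open import Function using (_∘_)
open import Relation.Binary.PropositionalEquality
  using (_≡_; _≢_; refl; sym; trans; cong; cong₂; subst; setoid; module ≡-Reasoning)
open import Relation.Nullary using (¬_; Dec; yes; no; contradiction; does; ¬?)
open import Relation.Nullary.Decidable using (decidable-stable; dec-true; dec-false)

-- The generators as permutations of `Fin (suc m)`.

-- γₚ c is γ(c + 1) in zero-based coordinates, for 0 ≤ c ≤ m; γₚ 0 is the identity.
γₚ : ∀ {m} → Fin (suc m) → Permutation′ (suc m)
γₚ c = insert zero c id

punchIn-below : ∀ {m} (c : Fin (suc m)) (i : Fin m) →
                toℕ i < toℕ c → toℕ (punchIn c i) ≡ toℕ i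
punchIn-below (suc c) zero    _         = refl
punchIn-below (suc c) (suc i) (s≤s i<c) = cong suc (punchIn-below c i i<c)

punchIn-above : ∀ {m} (c : Fin (suc m)) (i : Fin m) →
                toℕ c ≤ toℕ i → toℕ (punchIn c i) ≡ suc (toℕ i)
punchIn-above zero    i       _         = refl
punchIn-above (suc c) (suc i) (s≤s c≤i) = cong suc (punchIn-above c i c≤i)

γ≡γₚ : ∀ {m} (c x : Fin (suc m)) →
       γ (suc (toℕ c)) (suc (toℕ x)) ≡ suc (toℕ (γₚ c ⟨$⟩ʳ x))
γ≡γₚ c zero = refl
γ≡γₚ c (suc x) with suc (suc (toℕ x)) ≤? suc (toℕ c)
... | yes (s≤s x<c) = cong suc (sym (punchIn-below c x x<c))
... | no  x≮c       = cong suc (sym (punchIn-above c x (≮⇒≥ (x≮c ∘ s≤s))))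

-- The value is the same for all c > i, which is why the cycles with c ≥ r all shift places 1, ...,
-- r to 0, ..., r - 1 alike.
γₚ-suc : ∀ {m} (c i : Fin (suc m)) (i<m : toℕ i < m) → toℕ i < toℕ c →
         γₚ c ⟨$⟩ʳ suc (fromℕ< i<m) ≡ i
γₚ-suc c i i<m i<c = toℕ-injective (trans (punchIn-below c _ (subst (_< toℕ c) (sym eq) i<c)) eq)
  where eq = toℕ-fromℕ< i<m

-- Distinct letters, truncated lists and a pigeonhole principle.

unique-resp-↭ : ∀ {A : Set} {xs ys : List A} → xs ↭ ys → Unique xs → Unique ys
unique-resp-↭ = Permutationₛ.Unique-resp-↭ (setoid _) ∘ ↭⇒↭ₛ

unique-++⁻ʳ : ∀ {A : Set} (xs : List A) {ys} → Unique (xs ++ ys) → Unique ys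
unique-++⁻ʳ []       uniq       = uniq
unique-++⁻ʳ (x ∷ xs) (_ ∷ uniq) = unique-++⁻ʳ xs uniq

unique-++⇒∉ : ∀ {A : Set} (xs : List A) {ys y} → Unique (xs ++ ys) → y ∈ ys → y ∉ xs
unique-++⇒∉ (x ∷ xs) (x∉ ∷ _)   y∈ (here refl) = All¬⇒¬Any x∉ (∈-++⁺ʳ xs y∈)
unique-++⇒∉ (x ∷ xs) (_ ∷ uniq) y∈ (there y∈xs) = unique-++⇒∉ xs uniq y∈ y∈xs

take-length-++ : ∀ {A : Set} (xs ys : List A) → take (length xs) (xs ++ ys) ≡ xs
take-length-++ []       ys = refl
take-length-++ (x ∷ xs) ys = cong (x ∷_) (take-length-++ xs ys)

take-tabulate⁺ : ∀ {A : Set} {n} r {f g : Fin n → A} →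
                 (∀ i → toℕ i < r → f i ≡ g i) → take r (tabulate f) ≡ take r (tabulate g)
take-tabulate⁺ zero eq = refl
take-tabulate⁺ {n = zero} (suc r) eq = refl
take-tabulate⁺ {n = suc n} (suc r) eq
  rewrite eq zero (s≤s z≤n) = cong (_ ∷_) (take-tabulate⁺ r (λ i i<r → eq (suc i) (s≤s i<r)))

take-tabulate⁻ : ∀ {A : Set} {n} r {f g : Fin n → A} →
                 take r (tabulate f) ≡ take r (tabulate g) → ∀ i → toℕ i < r → f i ≡ g i
take-tabulate⁻ (suc r) eq zero    _         = ∷-injectiveˡ eq
take-tabulate⁻ (suc r) eq (suc i) (s≤s i<r) = take-tabulate⁻ r (∷-injectiveʳ eq) i i<r

-- `γₚ c` lists place c first and then the others through `punchIn c`, so the last two equations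
-- describe the list with y moved to the front.
tabulate-split : ∀ {A : Set} {m} (f : Fin (suc m) → A) p {y q} → tabulate f ≡ p ++ y ∷ q →
                 ∃[ c ] (toℕ c ≡ length p × f c ≡ y × tabulate (f ∘ punchIn c) ≡ p ++ q)
tabulate-split f [] eq = zero , refl , ∷-injectiveˡ eq , ∷-injectiveʳ eq
tabulate-split {m = zero}  f (x ∷ [])    ()
tabulate-split {m = zero}  f (x ∷ _ ∷ p) ()
tabulate-split {m = suc m} f (x ∷ p) eq with tabulate-split (f ∘ suc) p (∷-injectiveʳ eq)
... | c , c≡ , fc≡y , rest = suc c , cong suc c≡ , fc≡y , cong₂ _∷_ (∷-injectiveˡ eq) rest

missing : ∀ {n} (xs : List (Fin n)) → length xs < n → ∃[ y ] y ∉ xs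
missing {n} xs short with any? (λ y → ¬? (mem? _≟_ y xs))
... | yes found = found
... | no  none  = contradiction (injective⇒≤ inj) (<⇒≱ short)
  where
  all∈ : ∀ y → y ∈ xs
  all∈ y = decidable-stable (mem? _≟_ y xs) (λ y∉ → none (y , y∉))
  inj : ∀ {y z} → index (all∈ y) ≡ index (all∈ z) → y ≡ z
  inj {y} {z} eq = trans (lookup-index (all∈ y))
    (trans (cong (lookup xs) eq) (sym (lookup-index (all∈ z))))

-- Labels assigning words to routes.

module _ {n : ℕ} where

  -- The letter in front of the first non-initial b, or else the last letter.
  before : Fin n → List (Fin n) → Fin n
  before b []          = b
  before b (c ∷ [])    = c
  before b (c ∷ d ∷ l) = if does (d ≟ b) then c else before b (d ∷ l)

  -- The bound on t keeps y visible. If the cut falls right behind y, then a is lost and y is found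
  -- as the last letter.
  before-take : ∀ {r} t {y a} s → length t < r → a ∉ t → y ≢ a →
                before a (take r (t ++ y ∷ a ∷ s)) ≡ y
  before-take {suc zero} [] s _ _ _ = refl
  before-take {suc (suc r)} [] {a = a} s _ _ _ rewrite dec-true (a ≟ a) refl = refl
  before-take {suc zero} (_ ∷ _) _ (s≤s ()) _ _
  before-take {suc (suc r)} (x ∷ []) {y} {a} s (s≤s len) a∉t y≢a rewrite dec-false (y ≟ a) y≢a =
    before-take {suc r} [] s len (λ ()) y≢a
  before-take {suc (suc r)} (x ∷ z ∷ t) {y} {a} s (s≤s len) a∉t y≢a
    rewrite dec-false (z ≟ a) (λ z≡a → a∉t (there (here (sym z≡a)))) =
    before-take {suc r} (z ∷ t) s len (a∉t ∘ there) y≢a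

  before-++ : ∀ t {y a} s → a ∉ t → y ≢ a → before a (t ++ y ∷ a ∷ s) ≡ y
  before-++ t {y} {a} s a∉t y≢a = trans
    (cong (before a) (sym (take-all _ (t ++ y ∷ a ∷ s) ≤-refl)))
    (before-take t s (subst (length t <_) (sym (length-++ t)) (m<m+n (length t) (s≤s z≤n))) a∉t y≢a)

  -- Tells apart the routes that bring a to the front.
  firstOther : Fin n → List (Fin n) → Fin n
  firstOther a []          = a
  firstOther a (x ∷ [])    = x
  firstOther a (x ∷ z ∷ _) = if does (x ≟ a) then z else x

  firstOther-skip : ∀ {r a x s} → 2 ≤ r → firstOther a (take r (a ∷ x ∷ s)) ≡ x
  firstOther-skip {a = a} (s≤s (s≤s _)) rewrite dec-true (a ≟ a) refl = refl

  firstOther-here : ∀ {r a x z s} → 2 ≤ r → x ≢ a → firstOther a (take r (x ∷ z ∷ s)) ≡ x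
  firstOther-here {a = a} {x} (s≤s (s≤s _)) x≢a rewrite dec-false (x ≟ a) x≢a = refl

  -- The y on whose route to T a given word may lie.
  label : Fin n → List (Fin n) → List (Fin n) → Fin n
  label a T (x ∷ z ∷ l) = if does (x ≟ a) then before z T else before a (x ∷ z ∷ l)
  label a T l           = before a l

  label-head : ∀ {r} a T c s → 2 ≤ r → label a T (take r (a ∷ c ∷ s)) ≡ before c T
  label-head a T c s (s≤s (s≤s _)) rewrite dec-true (a ≟ a) refl = refl

  label-before : ∀ {r} T t {y a} s → 2 ≤ r → length t < r → a ∉ t → y ≢ a →
                 label a T (take r (t ++ y ∷ a ∷ s)) ≡ y
  label-before T [] {y} {a} s (s≤s (s≤s _)) len a∉t y≢a
    rewrite dec-false (y ≟ a) y≢a = before-take [] s len a∉t y≢a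
  label-before T (x ∷ []) {y} {a} s (s≤s (s≤s _)) len a∉t y≢a
    rewrite dec-false (x ≟ a) (λ x≡a → a∉t (here (sym x≡a))) =
    before-take (x ∷ []) s len a∉t y≢a
  label-before T (x ∷ z ∷ t) {y} {a} s (s≤s (s≤s _)) len a∉t y≢a
    rewrite dec-false (x ≟ a) (λ x≡a → a∉t (here (sym x≡a))) =
    before-take (x ∷ z ∷ t) s len a∉t y≢a

-- Cosets and edges in terms of the letters of g⁻¹.

toList : ∀ {n} → Permutation′ n → List (Fin n)
toList g = tabulate (g ⟨$⟩ˡ_)

toList-unique : ∀ {n} (g : Permutation′ n) → Unique (toList g)
toList-unique g = Uniqueₚ.tabulate⁺ λ eq →
  trans (sym (inverseʳ g)) (trans (cong (g ⟨$⟩ʳ_) eq) (inverseʳ g))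

∈-toList : ∀ {n} (g : Permutation′ n) y → y ∈ toList g
∈-toList g y = subst (_∈ toList g) (inverseˡ g) (∈-tabulate⁺ (g ⟨$⟩ʳ y))

-- For r ≥ 2 this gives a vertex that is neither `id` nor a predecessor of it: the first letter is
-- that of `id`, the second is not.
fix0-move1 : ∀ {m} → 2 ≤ m → ∃ λ (g : Permutation′ (suc m)) →
             g ⟨$⟩ˡ zero ≡ zero × ∃[ i ] (toℕ i ≡ 1 × g ⟨$⟩ˡ i ≢ i)
fix0-move1 (s≤s (s≤s _)) = lift₀ (flip (γₚ (suc zero))) , refl , suc zero , refl , λ ()

module _ (m k : ℕ) where

  private
    n r : ℕ
    n = suc m
    r = n ∸ k
    D : Digraph
    D = CP n k

  InH-flip : ∀ {h} → InH n k h → InH n k (flip h)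
  InH-flip {h} hH i i<r = trans (cong (h ⟨$⟩ˡ_) (sym (hH i i<r))) (inverseˡ h)

  sameCoset⁺ : ∀ u v → (∀ i → toℕ i < r → u ⟨$⟩ˡ i ≡ v ⟨$⟩ˡ i) → SameCoset n k u v
  sameCoset⁺ u v eq =
    flip u ∘ₚ v ,
    (λ i i<r → trans (cong (v ⟨$⟩ʳ_) (eq i i<r)) (inverseʳ v)) ,
    (λ i → cong (v ⟨$⟩ʳ_) (sym (inverseˡ u)))

  sameCoset⁻ : ∀ u v → SameCoset n k u v → ∀ i → toℕ i < r → u ⟨$⟩ˡ i ≡ v ⟨$⟩ˡ i
  sameCoset⁻ u v (h , hH , eq) i i<r = begin
    u ⟨$⟩ˡ i                            ≡⟨ inverseˡ v ⟨
    v ⟨$⟩ˡ (v ⟨$⟩ʳ (u ⟨$⟩ˡ i))          ≡⟨ cong (v ⟨$⟩ˡ_) (eq _) ⟩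
    v ⟨$⟩ˡ (h ⟨$⟩ʳ (u ⟨$⟩ʳ (u ⟨$⟩ˡ i))) ≡⟨ cong (λ x → v ⟨$⟩ˡ (h ⟨$⟩ʳ x)) (inverseʳ u) ⟩
    v ⟨$⟩ˡ (h ⟨$⟩ʳ i)                   ≡⟨ cong (v ⟨$⟩ˡ_) (hH i i<r) ⟩
    v ⟨$⟩ˡ i                            ∎
    where open ≡-Reasoning

  -- With h = u⁻¹vγ_c⁻¹ and h' = γ_c⁻¹γ_d, products read from left to right, both uhγ_d and vh' are
  -- vγ_c⁻¹γ_d.
  edge-via : ∀ u v c (d : Fin n) → 1 ≤ toℕ d → toℕ d ≤ r →
             InH n k (flip (γₚ c) ∘ₚ γₚ d) →
             (∀ i → toℕ i < r → u ⟨$⟩ˡ i ≡ v ⟨$⟩ˡ (γₚ c ⟨$⟩ʳ i)) → CPEdge n k u v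
  edge-via u v c d 1≤d d≤r h'H eq =
    suc (toℕ d) , s≤s 1≤d , s≤s d≤r ,
    flip u ∘ₚ v ∘ₚ flip (γₚ c) , flip (γₚ c) ∘ₚ γₚ d ,
    proj₁ (proj₂ (sameCoset⁺ u (v ∘ₚ flip (γₚ c)) eq)) , h'H ,
    λ i → trans (γ≡γₚ d (γₚ c ⟨$⟩ˡ (v ⟨$⟩ʳ (u ⟨$⟩ˡ (u ⟨$⟩ʳ i)))))
                (cong (λ x → suc (toℕ (γₚ d ⟨$⟩ʳ (γₚ c ⟨$⟩ˡ (v ⟨$⟩ʳ x))))) (inverseˡ u))

  -- All positions c ≥ r are served by the single generator γ(r + 1).
  edge⁺ : 1 ≤ r → r ≤ m → ∀ u v c → c ≢ zero →
          (∀ i → toℕ i < r → u ⟨$⟩ˡ i ≡ v ⟨$⟩ˡ (γₚ c ⟨$⟩ʳ i)) → CPEdge n k u v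
  edge⁺ 1≤r r≤m u v zero    c≢0 eq = contradiction refl c≢0
  edge⁺ 1≤r r≤m u v (suc c) c≢0 eq with suc (toℕ c) <? r
  ... | yes c<r = edge-via u v (suc c) (suc c) (s≤s z≤n) (<⇒≤ c<r) (λ _ _ → inverseʳ (γₚ (suc c))) eq
  ... | no  c≮r = edge-via u v (suc c) d
        (subst (1 ≤_) (sym d≡r) 1≤r) (≤-reflexive d≡r) fixes eq
    where
    d = fromℕ< (s≤s r≤m)
    d≡r = toℕ-fromℕ< (s≤s r≤m)
    fixes : InH n k (flip (γₚ (suc c)) ∘ₚ γₚ d)
    fixes i i<r = begin
      γₚ d ⟨$⟩ʳ (γₚ (suc c) ⟨$⟩ˡ i)
        ≡⟨ cong (λ x → γₚ d ⟨$⟩ʳ (γₚ (suc c) ⟨$⟩ˡ x)) (γₚ-suc (suc c) i i<m (<-≤-trans i<r (≮⇒≥ c≮r))) ⟨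
      γₚ d ⟨$⟩ʳ (γₚ (suc c) ⟨$⟩ˡ (γₚ (suc c) ⟨$⟩ʳ suc (fromℕ< i<m)))
        ≡⟨ cong (γₚ d ⟨$⟩ʳ_) (inverseˡ (γₚ (suc c)) {suc (fromℕ< i<m)}) ⟩
      γₚ d ⟨$⟩ʳ suc (fromℕ< i<m)
        ≡⟨ γₚ-suc d i i<m (subst (toℕ i <_) (sym d≡r) i<r) ⟩
      i ∎
      where
      open ≡-Reasoning
      i<m = <-≤-trans i<r r≤m

  -- At place 0 both sides are h(d). Elsewhere, if d < r, h fixes d and the place reached; if d = r,
  -- h keeps d outside the first r places, and cycles reaching that far agree.
  γₚ-commutes : ∀ {h} → InH n k h → (d : Fin n) → toℕ d ≤ r → ∀ i → toℕ i < r →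
                h ⟨$⟩ʳ (γₚ d ⟨$⟩ʳ i) ≡ γₚ (h ⟨$⟩ʳ d) ⟨$⟩ʳ i
  γₚ-commutes hH d d≤r zero 0<r = refl
  γₚ-commutes {h} hH d d≤r (suc i) i<r with toℕ d <? r
  ... | yes d<r rewrite hH d d<r with toℕ i <? toℕ d
  ...   | yes i<d = hH _ (subst (_< r) (sym (punchIn-below d i i<d)) (<⇒≤ i<r))
  ...   | no  i≮d = hH _ (subst (_< r) (sym (punchIn-above d i (≮⇒≥ i≮d))) i<r)
  γₚ-commutes {h} hH d d≤r (suc i) i<r | no d≮r = begin
    h ⟨$⟩ʳ punchIn d i   ≡⟨ hH _ (subst (_< r) (sym below) (<⇒≤ i<r)) ⟩
    punchIn d i          ≡⟨ toℕ-injective (trans below (sym below′)) ⟩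
    punchIn (h ⟨$⟩ʳ d) i ∎
    where
    open ≡-Reasoning
    below = punchIn-below d i (<-≤-trans (<⇒≤ i<r) (≮⇒≥ d≮r))
    hd≮r : ¬ toℕ (h ⟨$⟩ʳ d) < r
    hd≮r hd<r = d≮r (subst (λ x → toℕ x < r) hd≡d hd<r)
      where
      hd≡d : h ⟨$⟩ʳ d ≡ d
      hd≡d = trans (sym (inverseˡ h)) (trans (cong (h ⟨$⟩ˡ_) (hH _ hd<r)) (inverseˡ h))
    below′ = punchIn-below (h ⟨$⟩ʳ d) i (<-≤-trans (<⇒≤ i<r) (≮⇒≥ hd≮r))

  -- The edge says uhγ_d = vh'. At u⁻¹(i) with i < r the factor h disappears, and `γₚ-commutes`
  -- moves h'⁻¹ past γ_d, turning d into c = h'⁻¹(d).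
  edge⁻ : 1 ≤ r → r ≤ m → ∀ u v → CPEdge n k u v →
          ∃[ c ] (c ≢ zero × (∀ i → toℕ i < r → u ⟨$⟩ˡ i ≡ v ⟨$⟩ˡ (γₚ c ⟨$⟩ʳ i)))
  edge⁻ 1≤r r≤m u v (suc j , s≤s 1≤j , s≤s j≤r , h , h' , hH , h'H , eq) =
    h' ⟨$⟩ˡ d , c≢0 , agree
    where
    open ≡-Reasoning
    j<n = s≤s (≤-trans j≤r r≤m)
    d : Fin n
    d = fromℕ< j<n
    d≡j = toℕ-fromℕ< j<n
    c≢0 : h' ⟨$⟩ˡ d ≢ zero
    c≢0 c≡0 = contradiction (subst (1 ≤_) j≡0 1≤j) λ ()
      where
      j≡0 : j ≡ 0
      j≡0 = trans (sym d≡j)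
        (cong toℕ (trans (sym (inverseʳ h')) (trans (cong (h' ⟨$⟩ʳ_) c≡0) (h'H zero 1≤r))))
    key : ∀ x → γₚ d ⟨$⟩ʳ (h ⟨$⟩ʳ (u ⟨$⟩ʳ x)) ≡ h' ⟨$⟩ʳ (v ⟨$⟩ʳ x)
    key x = toℕ-injective (suc-injective
      (trans (sym (γ≡γₚ d y)) (trans (cong (λ j → γ (suc j) (suc (toℕ y))) d≡j) (eq x))))
      where y = h ⟨$⟩ʳ (u ⟨$⟩ʳ x)
    agree : ∀ i → toℕ i < r → u ⟨$⟩ˡ i ≡ v ⟨$⟩ˡ (γₚ (h' ⟨$⟩ˡ d) ⟨$⟩ʳ i)
    agree i i<r = begin
      u ⟨$⟩ˡ i
        ≡⟨ inverseˡ v ⟨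
      v ⟨$⟩ˡ (v ⟨$⟩ʳ (u ⟨$⟩ˡ i))
        ≡⟨ cong (v ⟨$⟩ˡ_) (inverseˡ h') ⟨
      v ⟨$⟩ˡ (h' ⟨$⟩ˡ (h' ⟨$⟩ʳ (v ⟨$⟩ʳ (u ⟨$⟩ˡ i))))
        ≡⟨ cong (λ x → v ⟨$⟩ˡ (h' ⟨$⟩ˡ x)) (key _) ⟨
      v ⟨$⟩ˡ (h' ⟨$⟩ˡ (γₚ d ⟨$⟩ʳ (h ⟨$⟩ʳ (u ⟨$⟩ʳ (u ⟨$⟩ˡ i)))))
        ≡⟨ cong (λ x → v ⟨$⟩ˡ (h' ⟨$⟩ˡ (γₚ d ⟨$⟩ʳ (h ⟨$⟩ʳ x)))) (inverseʳ u) ⟩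
      v ⟨$⟩ˡ (h' ⟨$⟩ˡ (γₚ d ⟨$⟩ʳ (h ⟨$⟩ʳ i)))
        ≡⟨ cong (λ x → v ⟨$⟩ˡ (h' ⟨$⟩ˡ (γₚ d ⟨$⟩ʳ x))) (hH i i<r) ⟩
      v ⟨$⟩ˡ (h' ⟨$⟩ˡ (γₚ d ⟨$⟩ʳ i))
        ≡⟨ cong (v ⟨$⟩ˡ_) (γₚ-commutes {flip h'} (InH-flip {h'} h'H) d (≤-trans (≤-reflexive d≡j) j≤r) i i<r) ⟩
      v ⟨$⟩ˡ (γₚ (h' ⟨$⟩ˡ d) ⟨$⟩ʳ i) ∎

  word : Permutation′ n → List (Fin n)
  word g = take r (toList g)

  word⇒sameCoset : ∀ u v → word u ≡ word v → SameCoset n k u v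
  word⇒sameCoset u v eq = sameCoset⁺ u v (take-tabulate⁻ r eq)

  sameCoset⇒word : ∀ u v → SameCoset n k u v → word u ≡ word v
  sameCoset⇒word u v eq = take-tabulate⁺ r (sameCoset⁻ u v eq)

  length-word : r ≤ m → ∀ g → length (word g) ≡ r
  length-word r≤m g = trans (length-take r (toList g))
    (m≤n⇒m⊓n≡m (≤-trans r≤m (≤-trans (n≤1+n m) (≤-reflexive (sym (length-tabulate (g ⟨$⟩ˡ_)))))))

  edge-respʳ : ∀ u v v' → SameCoset n k v v' → CPEdge n k u v → CPEdge n k u v'
  edge-respʳ u v v' (f , fH , v'≡) (j , 2≤j , j≤r , h , h' , hH , h'H , eq) =
    j , 2≤j , j≤r , h , flip f ∘ₚ h' , hH ,
    (λ i i<r → trans (cong (h' ⟨$⟩ʳ_) (InH-flip {f} fH i i<r)) (h'H i i<r)) ,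
    λ i → trans (eq i) (cong (λ x → suc (toℕ (h' ⟨$⟩ʳ x)))
                         (sym (trans (cong (f ⟨$⟩ˡ_) (v'≡ i)) (inverseˡ f))))

  -- `edge⁻` involves u' only through its first r letters, which u shares.
  edge-respˡ : 1 ≤ r → r ≤ m → ∀ u u' v → SameCoset n k u u' → CPEdge n k u' v → CPEdge n k u v
  edge-respˡ 1≤r r≤m u u' v u≈u' e with edge⁻ 1≤r r≤m u' v e
  ... | c , c≢0 , eq = edge⁺ 1≤r r≤m u v c c≢0
    (λ i i<r → trans (sameCoset⁻ u u' u≈u' i i<r) (eq i i<r))

  -- Routes of requests that avoid a deleted set.

  module _ (1≤r : 1 ≤ r) (r≤m : r ≤ m) (X : List (Permutation′ n)) (v : Permutation′ n) where

    Clear : List (Fin n) → Set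
    Clear L = take r L ∉ map word X

    clear⇒∉ : ∀ g → Clear (toList g) → ¬ _∈V_ D g X
    clear⇒∉ g clear g∈X = clear (go g∈X)
      where
      go : ∀ {Y} → _∈V_ D g Y → word g ∈ map word Y
      go {x ∷ _} (here g≈x) = here (sameCoset⇒word g x g≈x)
      go (there g∈Y) = there (go g∈Y)

    ∉⇒clear : ∀ g → ¬ _∈V_ D g X → Clear (toList g)
    ∉⇒clear g g∉X w∈ = g∉X (go w∈)
      where
      go : ∀ {Y} → word g ∈ map word Y → _∈V_ D g Y
      go {x ∷ _} (here eq)  = here (word⇒sameCoset g x eq)
      go {_ ∷ _} (there w∈) = there (go w∈)

    -- L is the whole list of letters, not just the word: a letter that has dropped off can then be
    -- requested like any other. The path ends in v and grows at its start.
    Reached : List (Fin n) → Set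
    Reached L = ∃[ g ] (toList g ≡ L × Clear L × PathAvoiding D X g v)

    reached-∈ : ∀ {L} → Reached L → ∀ y → y ∈ L
    reached-∈ (g , refl , _) y = ∈-toList g y

    access : ∀ p {y q} → Reached (p ++ y ∷ q) → Clear (y ∷ p ++ q) → Reached (y ∷ p ++ q)
    access [] reached _ = reached
    access (x ∷ p) (g , g≡ , clear , path) clear' with tabulate-split (g ⟨$⟩ˡ_) (x ∷ p) g≡
    ... | suc c , _ , gc≡y , rest =
      g ∘ₚ flip (γₚ (suc c)) , cong₂ _∷_ gc≡y rest , clear' ,
      -- The new vertex has an edge to g, so g is now entered by the path and must avoid X.
      step (edge⁺ 1≤r r≤m (g ∘ₚ flip (γₚ (suc c))) g (suc c) (λ ()) (λ _ _ → refl))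
           (clear⇒∉ g (subst Clear (sym g≡) clear)) path

    -- By distinctness each letter of t is fetched from behind q, so y stays directly in front of a,
    -- and every word met is one that `clear` covers.
    accessAll : ∀ {y a} → (∀ t s → length t < r → a ∉ t → Clear (t ++ y ∷ a ∷ s)) →
                ∀ t q s → length t < r → Unique (t ++ y ∷ a ∷ q) →
                Reached (y ∷ a ∷ q ++ s) → ∃[ s' ] Reached ((t ++ y ∷ a ∷ q) ++ s')
    accessAll clear [] q s _ _ reached = s , reached
    accessAll {y} {a} clear (z ∷ t) q s len (z∉ ∷ uniq) reached
      with accessAll clear t q s (<⇒≤ len) uniq reached
    ... | s' , reached' with ∈-++⁻ (t ++ y ∷ a ∷ q) (reached-∈ reached' z)
    ...   | inj₁ z∈ = contradiction z∈ (All¬⇒¬Any z∉)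
    ...   | inj₂ z∈ with ∈-∃++ z∈
    ...     | s₁ , s₂ , refl = s₁ ++ s₂ , subst (Reached ∘ (z ∷_)) (++-assoc w s₁ s₂)
              (access (w ++ s₁) (subst Reached (sym (++-assoc w s₁ (z ∷ s₂))) reached')
                (subst Clear (sym (cong (z ∷_) (trans (++-assoc w s₁ s₂) (++-assoc t _ _))))
                  (clear (z ∷ t) (q ++ s₁ ++ s₂) len a∉)))
      where
      w = t ++ y ∷ a ∷ q
      a∉ : a ∉ z ∷ t
      a∉ (here refl) = All¬⇒¬Any z∉ (∈-++⁺ʳ t (there (here refl)))
      a∉ (there a∈) = unique-++⇒∉ t uniq (there (here refl)) a∈

    -- Together with a, the labels of fewer than n - 1 deleted words cannot exhaust the n letters;
    -- no deleted word carries the label y.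
    avoidable : length X < m → (f : List (Fin n) → Fin n) (a : Fin n) →
                ∃[ y ] (y ≢ a × (∀ L → f (take r L) ≡ y → Clear L))
    avoidable short f a with missing (a ∷ map f (map word X))
      (s≤s (subst (_< m) (sym (trans (length-map f (map word X)) (length-map word X))) short))
    ... | y , y∉ = y , (y∉ ∘ here) , λ L eq L∈ →
      y∉ (there (subst (_∈ map f (map word X)) eq (∈-map⁺ f L∈)))

    reach-head : 2 ≤ r → length X < m → ∀ a {b S} → Reached (b ∷ S) → ∃[ S' ] Reached (a ∷ S')
    reach-head 2≤r short a {b} {S} reached with b ≟ a
    ... | yes refl = S , reached
    ... | no b≢a with avoidable short (firstOther a) a
    ...   | y , y≢a , clear with y ≟ b
    -- Route of b: request a at once; the word then starts with a b.
    ...     | yes refl with reached-∈ reached a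
    ...       | here a≡b = contradiction (sym a≡b) b≢a
    ...       | there a∈ with ∈-∃++ a∈
    ...         | p , q , refl = _ , access (b ∷ p) reached (clear _ (firstOther-skip {s = p ++ q} 2≤r))
    reach-head 2≤r short a {b} {S} reached | no b≢a | y , y≢a , clear | no y≢b with reached-∈ reached y
    ... | here y≡b = contradiction y≡b y≢b
    ... | there y∈ with ∈-∃++ y∈
    -- Any other route: request y, then a; the words start with y and with a y.
    ...   | p , q , refl with access (b ∷ p) reached (clear _ (firstOther-here {s = p ++ q} 2≤r y≢a))
    ...     | reached' with reached-∈ reached' a
    ...       | here a≡y = contradiction (sym a≡y) y≢a
    ...       | there a∈ with ∈-∃++ a∈
    ...         | p' , q' , eq = _ , access (y ∷ p') (subst (Reached ∘ (y ∷_)) eq reached')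
                                      (clear _ (firstOther-skip {s = p' ++ q'} 2≤r))

    bringFront : ∀ {y a} → (∀ t s → length t < r → a ∉ t → Clear (t ++ y ∷ a ∷ s)) →
                 ∀ p q s → length p < r → Unique (p ++ y ∷ a ∷ q) →
                 (∀ s' → Clear (a ∷ (p ++ [ y ]) ++ q ++ s')) →
                 Reached (y ∷ a ∷ q ++ s) → ∃[ s' ] Reached (a ∷ (p ++ [ y ]) ++ q ++ s')
    bringFront {y} {a} clear p q s len uniq final reached with accessAll clear p q s len uniq reached
    ... | s' , reached' = s' , access (p ++ [ y ])
      (subst Reached (trans (++-assoc p _ s') (sym (++-assoc p [ y ] _))) reached') (final s')

    -- A path is only tested at the vertices it enters, so its start may be exchanged for another
    -- representative of the coset.
    arrive : ∀ u {L} → Reached L → take r L ≡ word u → PathAvoiding D X u v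
    arrive u (g , refl , clear , stop g≈v) eq =
      stop (word⇒sameCoset u v (trans (sym eq) (sameCoset⇒word g v g≈v)))
    arrive u (g , refl , clear , step {w = w} e w∉X path) eq =
      step (edge-respˡ 1≤r r≤m u g w (word⇒sameCoset u g (sym eq)) e) w∉X path

    reach-word : 2 ≤ r → length X < m → ∀ u → ¬ _∈V_ D u X →
                 ∀ {a T S} → word u ≡ a ∷ T → Reached (a ∷ S) → PathAvoiding D X u v
    reach-word 2≤r short u u∉X {a} {T} {S} word≡ reached with avoidable short (label a (word u)) a
    ... | y , y≢a , clear with reached-∈ reached y
    ...   | here y≡a = contradiction y≡a y≢a
    ...   | there y∈S with ∈-∃++ y∈S
    ...     | s₁ , s₂ , refl = body (mem? _≟_ y T)
      where
      len : length (a ∷ T) ≡ r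
      len = trans (cong length (sym word≡)) (length-word r≤m u)

      uniq : Unique (a ∷ T)
      uniq = subst Unique word≡ (Uniqueₚ.take⁺ r (toList-unique u))

      clear-before : ∀ t s → length t < r → a ∉ t → Clear (t ++ y ∷ a ∷ s)
      clear-before t s t<r a∉t = clear _ (label-before (word u) t s 2≤r t<r a∉t y≢a)

      take≡word : ∀ s → take r (a ∷ T ++ s) ≡ word u
      take≡word s =
        trans (cong (λ l → take l (a ∷ T ++ s)) (sym len)) (trans (take-length-++ (a ∷ T) s) (sym word≡))

      clear-word : ∀ {L} → take r L ≡ word u → Clear L
      clear-word eq = subst (_∉ map word X) (sym eq) (∉⇒clear u u∉X)

      start : Reached (y ∷ a ∷ s₁ ++ s₂)
      start = access (a ∷ s₁) reached (clear-before [] _ 1≤r λ ())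

      finish : ∀ p q s (r' : List (Fin n) → List (Fin n)) →
               length p < r → Unique (p ++ y ∷ a ∷ q) →
               (∀ s' → (p ++ [ y ]) ++ q ++ s' ≡ T ++ r' s') →
               Reached (y ∷ a ∷ q ++ s) → PathAvoiding D X u v
      finish p q s r' p<r uniq' eq reached' =
        let s' , reached'' = bringFront clear-before p q s p<r uniq'
                             (λ s' → clear-word (take≡ s')) reached'
        in arrive u reached'' (take≡ s')
        where
        take≡ : ∀ s' → take r (a ∷ (p ++ [ y ]) ++ q ++ s') ≡ word u
        take≡ s' = trans (cong (λ l → take r (a ∷ l)) (eq s')) (take≡word (r' s'))

      body : Dec (y ∈ T) → PathAvoiding D X u v
      -- Here y ends up right behind the target word, outside its r places.
      body (no y∉T) = finish T [] (s₁ ++ s₂) (y ∷_) (≤-reflexive len)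
        (unique-resp-↭ (++-comm (y ∷ a ∷ []) T) ((y≢a ∷ ¬Any⇒All¬ T y∉T) ∷ uniq))
        (λ s' → ++-assoc T [ y ] s') start
      body (yes y∈T) with ∈-∃++ y∈T
      ... | p , q , refl = finish p q (proj₁ (turn q refl)) (λ s → s) p<r
        (unique-resp-↭ (↭-trans (↭-sym (shift a p (y ∷ q))) (++⁺ˡ p (↭-swap a y ↭-refl))) uniq)
        (λ s' → trans (++-assoc p [ y ] _) (sym (++-assoc p (y ∷ q) s'))) (proj₂ (turn q refl))
        where
        p<r : length p < r
        p<r = subst (length p <_) len (s≤s (subst (length p ≤_) (sym (length-++ p)) (m≤m+n (length p) _)))

        q<r : length q < r
        q<r = subst (length q <_) len (s≤s (subst (length q ≤_) (sym (length-++ p))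
          (≤-trans (n≤1+n (length q)) (m≤n+m (suc (length q)) (length p)))))

        uniq-ayq : Unique (a ∷ y ∷ q)
        uniq-ayq = unique-++⁻ʳ p (unique-resp-↭ (↭-sym (shift a p (y ∷ q))) uniq)

        -- The letters of q must stand behind y a before p is requested: they are brought in as q y
        -- a, then a and y are moved to the front.
        turn : ∀ q' → q' ≡ q → ∃[ s ] Reached (y ∷ a ∷ q' ++ s)
        turn [] _ = s₁ ++ s₂ , start
        turn q'@(c ∷ q₀) refl
          with accessAll clear-before q' [] (s₁ ++ s₂) q<r
                 (unique-resp-↭ (↭-trans (↭-swap a y ↭-refl) (++-comm (y ∷ a ∷ []) q')) uniq-ayq) start
        ... | s' , reached₁ = s' , access (a ∷ q')
          (subst Reached (cong (a ∷_) (++-assoc q' [ y ] s'))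
            (access (q' ++ [ y ])
              (subst Reached (trans (++-assoc q' _ s') (sym (++-assoc q' [ y ] _))) reached₁)
              -- This word starts with a c and has nothing in front of a; its label is y because y
              -- stands directly in front of c in the target word.
              (clear _ (trans (label-head a (word u) c _ 2≤r) (trans (cong (before c) word≡)
                (before-++ (a ∷ p) q₀ (unique-++⇒∉ (a ∷ p) uniq (there (here refl))) y≢c))))))
          (clear-before [] _ 1≤r λ ())
          where
          y≢c : y ≢ c
          y≢c refl with uniq-ayq
          ... | _ ∷ (y≢y ∷ _) ∷ _ = y≢y refl

    connected : 2 ≤ r → length X < m → ¬ _∈V_ D v X → ∀ u → ¬ _∈V_ D u X → PathAvoiding D X u v
    connected 2≤r short v∉X u u∉X with word u in word≡ | length-word r≤m u
    ... | []    | 0≡r = contradiction (subst (1 ≤_) (sym 0≡r) 1≤r) λ ()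
    ... | a ∷ T | _   = reach-word 2≤r short u u∉X word≡
      (proj₂ (reach-head 2≤r short a (v , refl , ∉⇒clear v v∉X , stop (sameCoset⁺ v v λ _ _ → refl))))

  -- The cut of n - 1 predecessors, the complete case and the theorem.

  module _ (1≤r : 1 ≤ r) (r≤m : r ≤ m) where

    -- The word of `rep c` is that of `id` with c moved to the front. For c ≠ 0 these are the
    -- predecessors of `id`; for r = 1 they and `rep zero` are all vertices.
    rep : Fin n → Permutation′ n
    rep c = flip (γₚ c)

    rep-distinct : ∀ {c d} → c ≢ d → ¬ SameCoset n k (rep c) (rep d)
    rep-distinct {c} {d} c≢d eq = c≢d (sameCoset⁻ (rep c) (rep d) eq zero 1≤r)

    predecessors : List (Permutation′ n)
    predecessors = tabulate (rep ∘ suc)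

    predecessors-distinct : DistinctV D predecessors
    predecessors-distinct = AllPairsₚ.tabulate⁺ (λ c≢d → rep-distinct (c≢d ∘ Finₚ.suc-injective))

    front0⇒∉predecessors : ∀ g → g ⟨$⟩ˡ zero ≡ zero → ¬ _∈V_ D g predecessors
    front0⇒∉predecessors g g0≡0 g∈ with Anyₚ.tabulate⁻ g∈
    ... | c , g≈ = contradiction (trans (sym g0≡0) (sameCoset⁻ g (rep (suc c)) g≈ zero 1≤r)) λ ()

    edge⇒∈predecessors : ∀ u → CPEdge n k u id → _∈V_ D u predecessors
    edge⇒∈predecessors u e with edge⁻ 1≤r r≤m u id e
    ... | zero  , c≢0 , _  = contradiction refl c≢0
    ... | suc c , _   , eq = Anyₚ.tabulate⁺ c (sameCoset⁺ u (rep (suc c)) eq)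

    -- As soon as a step of the path reaches `id`, its source is a predecessor and hence in the
    -- deleted set.
    predecessors-cut : ∀ u → ¬ SameCoset n k u id → ¬ _∈V_ D u predecessors →
                       ¬ PathAvoiding D predecessors u id
    predecessors-cut u u≉id u∉ (stop u≈id) = u≉id u≈id
    predecessors-cut u u≉id u∉ (step {w = w} e w∉ path) = predecessors-cut w
      (λ w≈id → u∉ (edge⇒∈predecessors u (edge-respʳ u w id w≈id e))) w∉ path

    only-zero : r ≡ 1 → ∀ {P : Fin n → Set} → (0 < r → P zero) → ∀ i → toℕ i < r → P i
    only-zero r≡1 p₀ zero    0<r = p₀ 0<r
    only-zero r≡1 p₀ (suc i) i<r with subst (suc (suc (toℕ i)) ≤_) r≡1 i<r
    ... | s≤s ()

    -- With one visible place a vertex is its single letter, and any letter other than the first can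
    -- be requested.
    complete : r ≡ 1 → Complete D
    complete r≡1 u v u≉v = edge⁺ 1≤r r≤m u v (v ⟨$⟩ʳ (u ⟨$⟩ˡ zero)) front≢
      (only-zero r≡1 λ _ → sym (inverseˡ v))
      where
      front≢ : v ⟨$⟩ʳ (u ⟨$⟩ˡ zero) ≢ zero
      front≢ eq = u≉v (sameCoset⁺ u v (only-zero r≡1 λ _ → trans (sym (inverseˡ v)) (cong (v ⟨$⟩ˡ_) eq)))

    order : r ≡ 1 → HasOrder D n
    order r≡1 = tabulate rep , AllPairsₚ.tabulate⁺ {f = rep} rep-distinct ,
      (λ v → Anyₚ.tabulate⁺ {f = rep} (v ⟨$⟩ˡ zero)
        (sameCoset⁺ v (rep (v ⟨$⟩ˡ zero)) (only-zero r≡1 λ _ → refl))) ,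
      length-tabulate rep

    connectivity : IsVertexConnectivity D m
    connectivity with m≤n⇒m<n∨m≡n 1≤r
    ... | inj₂ 1≡r = inj₁ (complete (sym 1≡r) , n , order (sym 1≡r) , refl)
    ... | inj₁ 2≤r with fix0-move1 (≤-trans 2≤r r≤m)
    ...   | g , g0≡0 , i , i≡1 , gi≢i = inj₂
      ( (λ full → g∉ (edge⇒∈predecessors g (full g id g≉id)))
      , (predecessors , predecessors-distinct , length-tabulate (rep ∘ suc)
        , λ sc → predecessors-cut g g≉id g∉ (sc g id g∉ (front0⇒∉predecessors id refl)))
      , λ X _ short u v u∉X v∉X → connected 1≤r r≤m X v 2≤r short v∉X u u∉X)
      where
      g∉ = front0⇒∉predecessors g g0≡0
      g≉id : ¬ SameCoset n k g id
      g≉id g≈id = gi≢i (sameCoset⁻ g id g≈id i (subst (_< r) (sym i≡1) 2≤r))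

theorem22 : ∀ (n k : ℕ) → 2 ≤ n → 1 ≤ k → k ≤ n ∸ 1 →
    IsVertexConnectivity (CP n k) (n ∸ 1)
theorem22 (suc m) k _ 1≤k k≤m = connectivity m k (m<n⇒0<n∸m (s≤s k≤m)) (∸-monoʳ-≤ (suc m) 1≤k)
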